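{- Let $\mathcal{P}_4$ be the family of planar graphs having girth at least $4$. The second player has a winning strategy in the game $BS_2(\mathcal{P}_4 : p, q)$ for all integers $p, q \geq 3$.
   Context: The girth of a graph is the length of a shortest cycle (infinite if there is no cycle); a pair of parallel edges counts as a cycle of length 2. The game $BS_2(\mathcal{P}_4:p,q)$ ($2$-Brussels sprout for $\mathcal{P}_4$) is the following two-player game, drawn in the plane. Initially there are two spots (vertices), having $p$ and $q$ open tips (short free partial edges) coming out of them, respectively. The players move alternately. A valid move consists of joining two distinct open tips by a curve that crosses neither itself nor any previously drawn curve, and then drawing a crossbar on this curve: the intersection of the crossbar with the curve is a new vertex, which has two new open tips, one on each side of the curve. The two joined tips are no longer open. The associated graph has as vertices the spots and the curve/crossbar intersections, and as edges the curve pieces joining two such vertices (so each move adds one vertex and two edges); it must belong to $\mathcal{P}_4$ at all times. The first player unable to make a valid move loses. -}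

module Defs where

open import Data.Bool using (Bool; true; false; not)
open import Data.Fin using (Fin; zero; suc; toℕ)
open import Data.List using (List; []; _∷_; _++_; map; length; lookup; replicate)
open import Data.List.Relation.Binary.Permutation.Propositional using (_↭_)
open import Data.Nat using (ℕ; suc; _+_; _*_; _≤_; NonZero)
open import Data.Nat.DivMod using (_mod_)
open import Data.Nat.GeneralisedArithmetic using (iterate)
open import Data.Product using (Σ-syntax; ∃-syntax; _×_; _,_; proj₁; proj₂)
open import Data.Sum using (_⊎_)
open import Function.Base using (_∘_)
open import Function.Bundles using (_⇔_)
open import Function.Definitions using (Injective; StrictlySurjective)
open import Relation.Binary.Construct.Closure.Equivalence using (EqClosure)
open import Relation.Binary.PropositionalEquality using (_≡_)

------------------------------------------------------------------------
-- Finite multigraphs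

-- Undirected; the order of the two endpoints of an edge carries no meaning.
record Graph (n : ℕ) : Set where
  constructor mkGraph
  field
    edges : List (Fin n × Fin n)

open Graph public

Family : Set₁
Family = ∀ {n} → Graph n → Set

module _ {n : ℕ} (G : Graph n) where

  -- A dart is an edge with one of its two directions.
  Dart : Set
  Dart = Fin (length (edges G)) × Bool

  edgeOf : Dart → Fin (length (edges G))
  edgeOf = proj₁

  rev : Dart → Dart
  rev (e , b) = e , not b

  tail : Dart → Fin n
  tail (e , false) = proj₁ (lookup (edges G) e)
  tail (e , true)  = proj₂ (lookup (edges G) e)

  head : Dart → Fin n
  head = tail ∘ rev

  -- Length 1 is a loop, and length 2 a pair of parallel edges.
  record Cycle (k : ℕ) .{{_ : NonZero k}} : Set where
    field
      dart             : Fin k → Dart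
      closed           : ∀ i → head (dart i) ≡ tail (dart (suc (toℕ i) mod k))
      distinctVertices : Injective _≡_ _≡_ (tail ∘ dart)
      distinctEdges    : Injective _≡_ _≡_ (edgeOf ∘ dart)

  -- Holds vacuously for acyclic graphs, whose girth is infinite.
  GirthAtLeast : ℕ → Set
  GirthAtLeast g = ∀ k .{{_ : NonZero k}} → Cycle k → g ≤ k

  SameOrbit : (Dart → Dart) → Dart → Dart → Set
  SameOrbit f d d′ = ∃[ k ] iterate f d k ≡ d′

  SameComponent : Dart → Dart → Set
  SameComponent = EqClosure (λ d d′ → tail d ≡ tail d′ ⊎ rev d ≡ d′)

  -- The relation R is an equivalence with exactly k classes.
  HasClasses : (Dart → Dart → Set) → ℕ → Set
  HasClasses R k =
    Σ[ class ∈ (Dart → Fin k) ]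
      StrictlySurjective _≡_ class × (∀ d d′ → R d d′ ⇔ class d ≡ class d′)

  -- A drawing of a connected graph on an oriented surface is encoded by
  -- the cyclic order σ of the darts leaving each vertex.  The condition
  -- isRotation makes σ a permutation with exactly one cycle per non-isolated
  -- vertex; the facial walks are then the orbits of σ ∘ rev.  Euler's formula,
  -- summed over the components that contain an edge (isolated vertices do not
  -- affect planarity), says that every such component has genus 0.
  record Planar : Set where
    field
      σ            : Dart → Dart
      isRotation   : ∀ d d′ → SameOrbit σ d d′ ⇔ tail d ≡ tail d′
      v f c        : ℕ
      vertices     : HasClasses (λ d d′ → tail d ≡ tail d′) v
      faces        : HasClasses (SameOrbit (σ ∘ rev)) f
      components   : HasClasses SameComponent c
      eulerFormula : v + f ≡ length (edges G) + 2 * c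

𝒫₄ : Family
𝒫₄ G = Planar G × GirthAtLeast G 4

------------------------------------------------------------------------
-- Positions of the game

-- A connected component of the boundary of a region, recorded as the cyclic
-- sequence of the open tips met when walking along it with the region on the
-- left.  A tip is written as the vertex it comes out of, so different tips
-- of one vertex are different entries of the list.
Boundary : ℕ → Set
Boundary n = List (Fin n)

-- A region of the complement of the drawing, as the unordered collection of
-- its boundary components; there may be several, since the drawing need not
-- be connected.
Region : ℕ → Set
Region n = List (Boundary n)

-- The drawing up to homeomorphism, as far as it matters for playing: which
-- curves can be drawn does not depend on which region is the unbounded one.
record Position (n : ℕ) : Set where
  constructor position
  field
    graph   : Graph n
    regions : List (Region n)

open Position public

-- Two lists that are the same cyclic sequence.
_≈ᶜ_ : ∀ {n} → Boundary n → Boundary n → Set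
b ≈ᶜ b′ = ∃[ xs ] ∃[ ys ] (b ≡ xs ++ ys × b′ ≡ ys ++ xs)

-- Every move creates one vertex: the new one is zero, and the old vertices
-- are shifted by suc.
shiftᵇ : ∀ {n} → Boundary n → Boundary (suc n)
shiftᵇ = map suc

shiftʳ : ∀ {n} → Region n → Region (suc n)
shiftʳ = map shiftᵇ

addPath : ∀ {n} → Fin n → Fin n → Graph n → Graph (suc n)
addPath u v G =
  mkGraph ((zero , suc u) ∷ (zero , suc v) ∷
           map (λ (x , y) → suc x , suc y) (edges G))

data Move {n : ℕ} (P : Position n) : Position (suc n) → Set where

  -- Both tips lie on the boundary component b of the region.  The curve cuts
  -- the region in two, each part receiving one of the two arcs of b, one of
  -- the new tips, and any share of the other boundary components.
  split : ∀ {R Rs b bs u v xs ys cs ds} →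
    regions P ↭ R ∷ Rs →
    R ↭ b ∷ bs →
    b ≈ᶜ (u ∷ xs ++ v ∷ ys) →
    bs ↭ cs ++ ds →
    Move P (position (addPath u v (graph P))
                     (((zero ∷ shiftᵇ xs) ∷ shiftʳ cs) ∷
                      ((zero ∷ shiftᵇ ys) ∷ shiftʳ ds) ∷
                      map shiftʳ Rs))

  -- The tips lie on different boundary components b and b′ of the region.
  -- The curve joins these into a single one and does not cut the region.
  merge : ∀ {R Rs b b′ bs u v xs ys} →
    regions P ↭ R ∷ Rs →
    R ↭ b ∷ b′ ∷ bs →
    b  ≈ᶜ (u ∷ xs) →
    b′ ≈ᶜ (v ∷ ys) →
    Move P (position (addPath u v (graph P))
                     (((zero ∷ shiftᵇ xs ++ zero ∷ shiftᵇ ys) ∷ shiftʳ bs) ∷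
                      map shiftʳ Rs))

-- The initial position: vertex 0 with p tips, and vertex 1 with q tips.
BS₂-start : ℕ → ℕ → Position 2
BS₂-start p q =
  position (mkGraph [])
           ((replicate p zero ∷ replicate q (suc zero) ∷ []) ∷ [])

------------------------------------------------------------------------
-- Winning strategies

module _ (𝒫 : Family) where

  ValidMove : ∀ {n} → Position n → Position (suc n) → Set
  ValidMove P Q = Move P Q × 𝒫 (graph Q)

  -- Winning strategies, from a given position, for the player about to move
  -- and for the opponent.  A player without a valid move has lost: then
  -- MoverWins is empty, and OpponentWins holds vacuously.
  data MoverWins    : ∀ {n} → Position n → Set
  data OpponentWins : ∀ {n} → Position n → Set

  data MoverWins where
    move : ∀ {n} {P : Position n} (Q : Position (suc n)) →
           ValidMove P Q → OpponentWins Q → MoverWins P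

  data OpponentWins where
    answer : ∀ {n} {P : Position n} →
             (∀ Q → ValidMove P Q → MoverWins Q) → OpponentWins P

  SecondPlayerWinsBS₂ : ℕ → ℕ → Set
  SecondPlayerWinsBS₂ p q = OpponentWins (BS₂-start p q)

{-# OPTIONS --safe #-}
module Submission where

-- Two tips can be joined exactly when their vertices are distinct and not
-- adjacent.  So the first move joins the two spots A and B, and the second one
-- joins them again, along a curve that cuts the plane in two.  The second
-- player chooses the tips of this curve such that all remaining tips of A lie
-- on one side and all those of B on the other.  Each side then shows the
-- cyclic sequence of tips w aᵏ z with k ≥ 1, where the crossbars w and z are
-- adjacent to a.  There one can only join w to z, which creates x, and the
-- second player then joins x to the first of the tips aᵏ; afterwards every two
-- tips of a common region belong to equal or adjacent vertices.  So the second
-- player always answers on the side of the last move, and makes the sixth and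
-- last move.

open import Defs
open import Data.Bool using (Bool; true; false; not; if_then_else_)
open import Data.Bool.Properties using (not-involutive; not-¬) renaming (_≟_ to _≟ᵇ_)
open import Data.Fin using (Fin; zero; suc; #_; toℕ; opposite; _↑ˡ_; _↑ʳ_)
open import Data.Fin.Properties using (any?; all?; suc-injective; opposite-involutive) renaming (_≟_ to _≟ᶠ_)
open import Data.List as List using (List; []; _∷_; [_]; _++_; length; map; concat; replicate; zip)
open import Data.List.Membership.Propositional using (_∈_)
open import Data.List.Membership.Propositional.Properties using (∈-map⁺; ∈-map⁻; ∈-++⁺ʳ; ∈-++⁻; ∈-concat⁺′)
import Data.List.Membership.DecPropositional as DecMembership
open import Data.List.Properties using (++-identityʳ; ++-assoc; map-++; map-replicate; concat-map; ∷-injective; ∷-injectiveʳ; length-replicate)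
open import Data.List.Relation.Binary.Permutation.Propositional using (_↭_; ↭-refl; ↭-sym; ↭-trans; ↭-swap; ↭-reflexive)
open import Data.List.Relation.Binary.Permutation.Propositional.Properties using (↭-empty-inv; ↭-singleton-inv; ↭-length; ∈-resp-↭; All-resp-↭; drop-∷; ++-comm)
open import Data.List.Relation.Unary.All as All using (All; []; _∷_)
import Data.List.Relation.Unary.All.Properties as All
open import Data.List.Relation.Unary.Any as Any using (here; there)
open import Data.List.Relation.Unary.Any.Properties using (lookup-index)
open import Data.Maybe as Maybe using (Maybe; just; nothing; maybe; fromMaybe)
open import Data.Nat using (ℕ; zero; suc; _+_; _≤_; NonZero; z≤n; s≤s)
open import Data.Nat.DivMod using (_mod_)
open import Data.Nat.GeneralisedArithmetic using (iterate)
import Data.Nat.Properties as ℕ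
open import Data.Product using (∃; ∃-syntax; _×_; _,_; proj₁; proj₂; map₁; uncurry)
open import Data.Product.Properties using (≡-dec)
open import Data.Sum as Sum using (_⊎_; inj₁; inj₂)
open import Data.Unit using (tt)
open import Data.Vec using (Vec; []; _∷_; lookup)
open import Function.Base using (_∘_; id)
open import Function.Bundles using (_⇔_; mk⇔)
open import Relation.Binary.Construct.Closure.Equivalence using (symmetric)
open import Relation.Binary.Construct.Closure.ReflexiveTransitive using (_◅_; _◅◅_; return)
open import Relation.Binary.Construct.Closure.Symmetric using (fwd)
open import Relation.Binary.PropositionalEquality using (_≡_; _≢_; refl; sym; trans; cong; cong₂; subst)
open import Relation.Nullary using (¬_; Dec; does; yes; no; contradiction)
open import Relation.Nullary.Decidable using (map′; toWitness; _×-dec_; _⊎-dec_; _→-dec_)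
open import Relation.Unary using (Decidable)

-- Finite certificates for planarity and girth

iterate-+ : ∀ {A : Set} (f : A → A) x j k → iterate f x (j + k) ≡ iterate f (iterate f x j) k
iterate-+ f x zero    k = refl
iterate-+ f x (suc j) k = iterate-+ f (f x) j k

module _ {n : ℕ} (G : Graph n) where

  _≟ᵈ_ : (d d′ : Dart G) → Dec (d ≡ d′)
  _≟ᵈ_ = ≡-dec _≟ᶠ_ _≟ᵇ_

  open DecMembership (≡-dec (_≟ᶠ_ {n}) (_≟ᶠ_ {n})) using (_∈?_)

  anyDart? : {P : Dart G → Set} → Decidable P → Dec (∃ P)
  anyDart? P? = map′
    (λ { (e , inj₁ p) → (e , false) , p ; (e , inj₂ p) → (e , true) , p })
    (λ { ((e , false) , p) → e , inj₁ p ; ((e , true) , p) → e , inj₂ p })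
    (any? λ e → P? (e , false) ⊎-dec P? (e , true))

  allDarts? : {P : Dart G → Set} → Decidable P → Dec (∀ d → P d)
  allDarts? P? = map′
    (λ { p (e , false) → proj₁ (p e) ; p (e , true) → proj₂ (p e) })
    (λ p e → p (e , false) , p (e , true))
    (all? λ e → P? (e , false) ×-dec P? (e , true))

  -- Unlike `SameOrbit`, this looks only boundedly many steps ahead and so can be decided by
  -- computation.
  ReachesWithin : ℕ → (Dart G → Dart G) → Dart G → Dart G → Set
  ReachesWithin zero    f d d′ = d ≡ d′
  ReachesWithin (suc N) f d d′ = d ≡ d′ ⊎ ReachesWithin N f (f d) d′

  reachesWithin? : ∀ N f d d′ → Dec (ReachesWithin N f d d′)
  reachesWithin? zero    f d d′ = d ≟ᵈ d′
  reachesWithin? (suc N) f d d′ = d ≟ᵈ d′ ⊎-dec reachesWithin? N f (f d) d′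

  reaches⇒sameOrbit : ∀ N {f d d′} → ReachesWithin N f d d′ → SameOrbit G f d d′
  reaches⇒sameOrbit zero    eq        = 0 , eq
  reaches⇒sameOrbit (suc N) (inj₁ eq) = 0 , eq
  reaches⇒sameOrbit (suc N) (inj₂ p)  = let (k , eq) = reaches⇒sameOrbit N p in suc k , eq

  -- A certificate that the orbits of `f` are the fibres of `class`: an orbit stays in one fibre,
  -- and any dart of a fibre leads to any other by way of the representative. Hence reachability is
  -- asked in both directions.
  record Orbits {k : ℕ} (N : ℕ) (f : Dart G → Dart G)
                (class : Dart G → Fin k) (rep : Fin k → Dart G) : Set where
    constructor orbits
    field
      invariant : ∀ d → class (f d) ≡ class d
      fromRep   : ∀ d → ReachesWithin N f (rep (class d)) d
      toRep     : ∀ d → ReachesWithin N f d (rep (class d))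
      class-rep : ∀ i → class (rep i) ≡ i

    invariant* : ∀ k d → class (iterate f d k) ≡ class d
    invariant* zero    d = refl
    invariant* (suc k) d = trans (invariant* k (f d)) (invariant d)

    sameOrbit⇔ : ∀ d d′ → SameOrbit G f d d′ ⇔ class d ≡ class d′
    sameOrbit⇔ d d′ = mk⇔
      (λ { (k , refl) → sym (invariant* k d) })
      (λ eq → let (j , p) = reaches⇒sameOrbit N (toRep d)
                  (k , q) = reaches⇒sameOrbit N (fromRep d′)
              in j + k ,
                 trans (iterate-+ f d j k)
                   (trans (cong (λ r → iterate f r k) (trans p (cong rep eq))) q))

    hasClasses : HasClasses G (SameOrbit G f) k
    hasClasses = class , (λ i → rep i , class-rep i) , sameOrbit⇔

  orbits? : ∀ {k} N f (class : Dart G → Fin k) rep → Dec (Orbits N f class rep)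
  orbits? N f class rep = map′
    (λ { (a , b , c , d) → orbits a b c d })
    (λ { (orbits a b c d) → a , b , c , d })
    (allDarts? (λ d → class (f d) ≟ᶠ class d)
      ×-dec allDarts? (λ d → reachesWithin? N f (rep (class d)) d)
      ×-dec allDarts? (λ d → reachesWithin? N f d (rep (class d)))
      ×-dec all? (λ i → class (rep i) ≟ᶠ i))

  Walk : ℕ → Fin n → Fin n → Set
  Walk zero    u v = u ≡ v
  Walk (suc k) u v = u ≡ v ⊎ (∃[ d ] tail G d ≡ u × Walk k (head G d) v)

  walk? : ∀ k u v → Dec (Walk k u v)
  walk? zero    u v = u ≟ᶠ v
  walk? (suc k) u v =
    u ≟ᶠ v ⊎-dec anyDart? λ d → tail G d ≟ᶠ u ×-dec walk? k (head G d) v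

  -- Each step of the walk becomes two links: to a dart with the same tail, then to its reverse,
  -- which starts at the next vertex.
  walk⇒sameComponent : ∀ k d d′ → Walk k (tail G d) (tail G d′) → SameComponent G d d′
  walk⇒sameComponent zero    d d′ eq       = return (fwd (inj₁ eq))
  walk⇒sameComponent (suc k) d d′ (inj₁ eq) = return (fwd (inj₁ eq))
  walk⇒sameComponent (suc k) d d′ (inj₂ (e , eq , w)) =
    fwd (inj₁ (sym eq)) ◅ fwd (inj₂ refl) ◅ walk⇒sameComponent k (rev G e) d′ w

  -- In a simple graph darts are named by their end vertices, so rotation lists
  -- neighbours and faces lists the vertices along each face.  The arbitrary
  -- defaults, such as d₀, make all functions total; Valid refutes bad data.  Its
  -- argument bounds the degrees, the face lengths and the distances to d₀.
  module Embedding (d₀ : Dart G) (rotation : Vec (List (Fin n)) n)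
                   {f : ℕ} (faces : Vec (List (Fin n)) (suc f)) where

    find : (es : List (Fin n × Fin n)) → Fin n → Fin n → Maybe (Fin (length es) × Bool)
    find []             u v = nothing
    find ((x , y) ∷ es) u v =
      if does (x ≟ᶠ u ×-dec y ≟ᶠ v) then just (zero , false) else
      if does (x ≟ᶠ v ×-dec y ≟ᶠ u) then just (zero , true) else
      Maybe.map (map₁ suc) (find es u v)

    dartBetween : Fin n → Fin n → Dart G
    dartBetween u v = fromMaybe d₀ (find (edges G) u v)

    cyclicSteps : List (Fin n) → List (Fin n × Fin n)
    cyclicSteps []       = []
    cyclicSteps (x ∷ xs) = zip (x ∷ xs) (xs ++ x ∷ [])

    cyclicNext : List (Fin n) → Fin n → Fin n
    cyclicNext xs v with any? (λ i → proj₁ (List.lookup (cyclicSteps xs) i) ≟ᶠ v)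
    ... | yes (i , _) = proj₂ (List.lookup (cyclicSteps xs) i)
    ... | no  _       = v

    σ : Dart G → Dart G
    σ d = dartBetween (tail G d) (cyclicNext (lookup rotation (tail G d)) (head G d))

    φ : Dart G → Dart G
    φ = σ ∘ rev G

    vertexRep : Fin n → Dart G
    vertexRep v = maybe (dartBetween v) d₀ (List.head (lookup rotation v))

    faceRep : Fin (suc f) → Dart G
    faceRep i = maybe (uncurry dartBetween) d₀ (List.head (cyclicSteps (lookup faces i)))

    face : Dart G → Fin (suc f)
    face d with any? (λ i → (tail G d , head G d) ∈? cyclicSteps (lookup faces i))
    ... | yes (i , _) = i
    ... | no  _       = zero

    Valid : ℕ → Set
    Valid N =
      Orbits N σ (tail G) vertexRep ×
      Orbits N φ face faceRep ×
      (∀ d → Walk N (tail G d) (tail G d₀)) ×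
      n + suc f ≡ length (edges G) + 2

    valid? : ∀ N → Dec (Valid N)
    valid? N =
      orbits? N σ (tail G) vertexRep ×-dec
      orbits? N φ face faceRep ×-dec
      allDarts? (λ d → walk? N (tail G d) (tail G d₀)) ×-dec
      (n + suc f ℕ.≟ length (edges G) + 2)

    -- By `class-rep` every vertex has a dart leaving it, so all `n` vertices count in Euler's
    -- formula; the walks to `d₀` leave a single component.
    planar : ∀ {N} → Valid N → Planar G
    planar {N} (vs , fs , conn , euler) = record
      { σ            = σ
      ; isRotation   = Orbits.sameOrbit⇔ vs
      ; v            = n
      ; f            = suc f
      ; c            = 1
      ; vertices     = tail G , (λ v → vertexRep v , Orbits.class-rep vs v) ,
                       (λ d d′ → mk⇔ id id)
      ; faces        = Orbits.hasClasses fs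
      ; components   = (λ _ → zero) , (λ { zero → d₀ , refl }) ,
                       (λ d d′ → mk⇔ (λ _ → refl) (λ _ →
                          connected d ◅◅ symmetric _ (connected d′)))
      ; eulerFormula = euler
      }
      where
      connected : ∀ d → SameComponent G d d₀
      connected d = walk⇒sameComponent N d d₀ (conn d)

  record Bipartite (colour : Fin n → Bool) : Set where
    constructor bipartite
    field
      proper : ∀ d → colour (head G d) ≡ not (colour (tail G d))
      simple : ∀ d d′ → head G d ≡ tail G d′ → head G d′ ≡ tail G d → edgeOf G d ≡ edgeOf G d′

  bipartite? : ∀ colour → Dec (Bipartite colour)
  bipartite? colour = map′ (λ { (a , b) → bipartite a b }) (λ { (bipartite a b) → a , b })
    (allDarts? (λ d → colour (head G d) ≟ᵇ not (colour (tail G d)))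
      ×-dec allDarts? λ d → allDarts? λ d′ →
        head G d ≟ᶠ tail G d′ →-dec head G d′ ≟ᶠ tail G d →-dec edgeOf G d ≟ᶠ edgeOf G d′)

  -- Colours alternate along a cycle, so its length is neither 1 nor 3. Length 2 would need parallel
  -- edges, which `simple` excludes.
  bipartite⇒girth≥4 : ∀ {colour} → Bipartite colour → GirthAtLeast G 4
  bipartite⇒girth≥4 {colour} (bipartite proper simple) = girth
    where
    alternates : ∀ k .{{_ : NonZero k}} (C : Cycle G k) i →
                 colour (tail G (Cycle.dart C (suc (toℕ i) mod k))) ≡
                 not (colour (tail G (Cycle.dart C i)))
    alternates k C i = trans (cong colour (sym (Cycle.closed C i))) (proper (Cycle.dart C i))
    girth : GirthAtLeast G 4
    girth 1 C = contradiction (alternates 1 C zero) (not-¬ refl)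
    girth 2 C with distinctEdges (simple (dart zero) (dart (suc zero)) (closed zero) (closed (suc zero)))
      where open Cycle C
    ... | ()
    girth 3 C = contradiction
      (trans (alternates 3 C (suc (suc zero))) (cong not
        (trans (alternates 3 C (suc zero))
          (trans (cong not (alternates 3 C zero)) (not-involutive _)))))
      (not-¬ refl)
    girth (suc (suc (suc (suc k)))) C = s≤s (s≤s (s≤s (s≤s z≤n)))

-- Graphs of the play

-- graph₂, graph₄ and graph₆ are the graphs after two, four and six moves, with
-- the vertices numbered from the newest to the oldest.  The first curve starts
-- at spot i and the third move is made on the side of the tips of spot c.  The
-- third and the fifth move join the crossbars of the first two moves, in the
-- order given by j and k.
graph₂ : Fin 2 → Graph 4
graph₂ i = addPath (suc i) (suc (opposite i)) (addPath i (opposite i) (mkGraph []))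

addAnswered : ∀ {n} → Fin n → Fin n → Fin n → Graph n → Graph (2 + n)
addAnswered s t a G = addPath zero (suc a) (addPath s t G)

graph₄ : Fin 2 → Fin 2 → Fin 2 → Graph 6
graph₄ i c j = addAnswered (j ↑ˡ 2) (opposite j ↑ˡ 2) (2 ↑ʳ c) (graph₂ i)

graph₆ : Fin 2 → Fin 2 → Fin 2 → Fin 2 → Graph 8
graph₆ i c j k = addAnswered (2 ↑ʳ (k ↑ˡ 2)) (2 ↑ʳ (opposite k ↑ˡ 2)) (4 ↑ʳ opposite c) (graph₄ i c j)

-- The graph is a 4-cycle through both spots and both crossbars; its two faces are this cycle in its
-- two directions.
graph₂-𝒫₄ : ∀ i → 𝒫₄ (graph₂ i)
graph₂-𝒫₄ i =
  Embedding₂.planar i (proj₁ (valid i)) , bipartite⇒girth≥4 (graph₂ i) (proj₂ (valid i))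
  where
  module Embedding₂ (i : Fin 2) = Embedding (graph₂ i) (zero , false)
    ((# 2 ∷ # 3 ∷ []) ∷ (# 2 ∷ # 3 ∷ []) ∷ (# 0 ∷ # 1 ∷ []) ∷ (# 0 ∷ # 1 ∷ []) ∷ [])
    ((# 0 ∷ # 2 ∷ # 1 ∷ # 3 ∷ []) ∷ (# 2 ∷ # 0 ∷ # 3 ∷ # 1 ∷ []) ∷ [])
  colour : Fin 4 → Bool
  colour = lookup (true ∷ true ∷ false ∷ false ∷ [])
  valid : ∀ i → Embedding₂.Valid i 4 × Bipartite (graph₂ i) colour
  valid = toWitness {a? = all? λ i →
    Embedding₂.valid? i 4 ×-dec bipartite? (graph₂ i) colour} tt

-- All four faces are quadrilaterals. One rotation serves all `i` and `j`, since these affect only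
-- the order in which the edges are listed.
graph₄-𝒫₄ : ∀ i c j → 𝒫₄ (graph₄ i c j)
graph₄-𝒫₄ i c j =
  Embedding₄.planar i c j (proj₁ (valid i c j)) ,
  bipartite⇒girth≥4 (graph₄ i c j) (proj₂ (valid i c j))
  where
  spot : Fin 2 → Fin 6
  spot = 4 ↑ʳ_
  atSpot : Fin 2 → Fin 2 → List (Fin 6)
  atSpot c e = if does (c ≟ᶠ e) then # 3 ∷ # 2 ∷ # 0 ∷ [] else # 3 ∷ # 2 ∷ []
  module Embedding₄ (i c j : Fin 2) = Embedding (graph₄ i c j) (zero , false)
    ((# 1 ∷ spot c ∷ []) ∷
     (# 3 ∷ # 0 ∷ # 2 ∷ []) ∷
     (spot c ∷ spot (opposite c) ∷ # 1 ∷ []) ∷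
     (spot c ∷ # 1 ∷ spot (opposite c) ∷ []) ∷
     atSpot c zero ∷ atSpot c (suc zero) ∷ [])
    ((# 0 ∷ # 1 ∷ # 2 ∷ spot c ∷ []) ∷
     (# 1 ∷ # 0 ∷ spot c ∷ # 3 ∷ []) ∷
     (# 2 ∷ # 1 ∷ # 3 ∷ spot (opposite c) ∷ []) ∷
     (# 3 ∷ spot c ∷ # 2 ∷ spot (opposite c) ∷ []) ∷ [])
  colour : Fin 6 → Bool
  colour = lookup (true ∷ false ∷ true ∷ true ∷ false ∷ false ∷ [])
  valid : ∀ i c j → Embedding₄.Valid i c j 4 × Bipartite (graph₄ i c j) colour
  valid = toWitness {a? = all? λ i → all? λ c → all? λ j →
    Embedding₄.valid? i c j 4 ×-dec bipartite? (graph₄ i c j) colour} tt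

graph₆-𝒫₄ : ∀ i c j k → 𝒫₄ (graph₆ i c j k)
graph₆-𝒫₄ i c j k =
  Embedding₆.planar i c j k (proj₁ (valid i c j k)) ,
  bipartite⇒girth≥4 (graph₆ i c j k) (proj₂ (valid i c j k))
  where
  spot : Fin 2 → Fin 8
  spot = 6 ↑ʳ_
  atSpot : Fin 2 → Fin 2 → List (Fin 8)
  -- The crossbar of the fourth move is adjacent to spot `c`, and that of the sixth to the other
  -- spot.
  atSpot c e = # 5 ∷ # 4 ∷ (if does (c ≟ᶠ e) then # 2 else # 0) ∷ []
  module Embedding₆ (i c j k : Fin 2) = Embedding (graph₆ i c j k) (zero , false)
    ((# 1 ∷ spot (opposite c) ∷ []) ∷
     (# 5 ∷ # 0 ∷ # 4 ∷ []) ∷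
     (# 3 ∷ spot c ∷ []) ∷
     (# 5 ∷ # 2 ∷ # 4 ∷ []) ∷
     (spot c ∷ # 1 ∷ spot (opposite c) ∷ # 3 ∷ []) ∷
     (spot c ∷ # 3 ∷ spot (opposite c) ∷ # 1 ∷ []) ∷
     atSpot c zero ∷ atSpot c (suc zero) ∷ [])
    ((# 0 ∷ # 1 ∷ # 4 ∷ spot (opposite c) ∷ []) ∷
     (# 1 ∷ # 0 ∷ spot (opposite c) ∷ # 5 ∷ []) ∷
     (# 2 ∷ # 3 ∷ # 4 ∷ spot c ∷ []) ∷
     (# 3 ∷ # 2 ∷ spot c ∷ # 5 ∷ []) ∷
     (# 4 ∷ # 1 ∷ # 5 ∷ spot c ∷ []) ∷
     (# 4 ∷ # 3 ∷ # 5 ∷ spot (opposite c) ∷ []) ∷ [])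
  colour : Fin 8 → Bool
  colour = lookup (true ∷ false ∷ true ∷ false ∷ true ∷ true ∷ false ∷ false ∷ [])
  -- The bound 4 is the distance between the vertices 0 and 2, the crossbars of the sixth and the
  -- fourth move.
  valid : ∀ i c j k → Embedding₆.Valid i c j k 4 × Bipartite (graph₆ i c j k) colour
  valid = toWitness {a? = all? λ i → all? λ c → all? λ j → all? λ k →
    Embedding₆.valid? i c j k 4 ×-dec bipartite? (graph₆ i c j k) colour} tt

-- Joins that create a short cycle

Adjacent : ∀ {n} → Graph n → Fin n → Fin n → Set
Adjacent G u v = (u , v) ∈ edges G ⊎ (v , u) ∈ edges G

Close : ∀ {n} → Graph n → Fin n → Fin n → Set
Close G u v = u ≡ v ⊎ Adjacent G u v

module _ {n : ℕ} {G : Graph n} where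

  close-sym : ∀ {u v} → Close G u v → Close G v u
  close-sym (inj₁ eq) = inj₁ (sym eq)
  close-sym (inj₂ uv) = inj₂ (Sum.swap uv)

  close-addPath : ∀ {s t u v} → Close G u v → Close (addPath s t G) (suc u) (suc v)
  close-addPath (inj₁ eq) = inj₁ (cong suc eq)
  close-addPath (inj₂ uv) = inj₂ (Sum.map lift lift uv)
    where
    lift : ∀ {s t x y} → (x , y) ∈ edges G → (suc x , suc y) ∈ edges (addPath s t G)
    lift p = there (there (∈-map⁺ _ p))

  close-crossbar : ∀ {s t} → Close (addPath s t G) zero (suc t)
  close-crossbar = inj₂ (inj₁ (there (here refl)))

  loopDigon : ∀ u → Cycle (addPath u u G) 2
  loopDigon u = record
    { dart             = λ { zero → zero , false ; (suc zero) → suc zero , true }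
    ; closed           = λ { zero → refl ; (suc zero) → refl }
    ; distinctVertices = λ { {zero} {zero} _ → refl ; {suc zero} {suc zero} _ → refl
                           ; {zero} {suc zero} () ; {suc zero} {zero} () }
    ; distinctEdges    = λ { {zero} {zero} _ → refl ; {suc zero} {suc zero} _ → refl
                           ; {zero} {suc zero} () ; {suc zero} {zero} () }
    }

  -- The cycle runs from `u` to the crossbar, on to `v` and back along an old edge. The two new
  -- edges come first in the list, which shifts the index of the old one by two.
  triangle : ∀ {u v} → u ≢ v → ∀ e b (let d = (suc (suc e) , b)) →
             tail (addPath u v G) d ≡ suc v → head (addPath u v G) d ≡ suc u →
             Cycle (addPath u v G) 3
  triangle {u} {v} u≢v e b tail≡ head≡ = record
    { dart             = dart
    ; closed           = λ { zero → refl ; (suc zero) → sym tail≡ ; (suc (suc zero)) → head≡ }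
    ; distinctVertices = injective (λ ()) (λ eq → u≢v (suc-injective (trans eq tail≡)))
                                   (λ eq → contradiction (trans eq tail≡) λ ())
    ; distinctEdges    = injective (λ ()) (λ ()) (λ ())
    }
    where
    dart : Fin 3 → Dart (addPath u v G)
    dart zero             = zero , true
    dart (suc zero)       = suc zero , false
    dart (suc (suc zero)) = suc (suc e) , b
    injective : ∀ {A : Set} {f : Fin 3 → A} →
                f zero ≢ f (suc zero) → f zero ≢ f (suc (suc zero)) →
                f (suc zero) ≢ f (suc (suc zero)) → ∀ {i j} → f i ≡ f j → i ≡ j
    injective p q r {zero}         {zero}         _  = refl
    injective p q r {zero}         {suc zero}     eq = contradiction eq p
    injective p q r {zero}         {suc (suc zero)} eq = contradiction eq q
    injective p q r {suc zero}     {zero}         eq = contradiction (sym eq) p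
    injective p q r {suc zero}     {suc zero}     _  = refl
    injective p q r {suc zero}     {suc (suc zero)} eq = contradiction eq r
    injective p q r {suc (suc zero)} {zero}       eq = contradiction (sym eq) q
    injective p q r {suc (suc zero)} {suc zero}   eq = contradiction (sym eq) r
    injective p q r {suc (suc zero)} {suc (suc zero)} _ = refl

  -- If `u` and `v` coincide, the two halves of the curve are parallel edges; otherwise they form a
  -- triangle with the edge between `u` and `v`.
  close⇒girth<4 : ∀ {u v} → Close G u v → ¬ GirthAtLeast (addPath u v G) 4
  close⇒girth<4 {u} {v} close girth with u ≟ᶠ v
  ... | yes refl with girth 2 (loopDigon u)
  ...   | s≤s (s≤s ())
  close⇒girth<4 (inj₁ u≡v) girth | no u≢v = u≢v u≡v
  close⇒girth<4 {u} {v} (inj₂ uv) girth | no u≢v with girth 3 (cycle uv)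
    where
    edge : ∀ {x y} → (x , y) ∈ edges G → (suc x , suc y) ∈ map (λ (x , y) → suc x , suc y) (edges G)
    edge = ∈-map⁺ _
    cycle : Adjacent G u v → Cycle (addPath u v G) 3
    cycle (inj₁ p) = triangle u≢v (Any.index (edge p)) true
      (sym (cong proj₂ (lookup-index (edge p)))) (sym (cong proj₁ (lookup-index (edge p))))
    cycle (inj₂ p) = triangle u≢v (Any.index (edge p)) false
      (sym (cong proj₁ (lookup-index (edge p)))) (sym (cong proj₂ (lookup-index (edge p))))
  ... | s≤s (s≤s (s≤s ()))

-- Cyclic sequences of tips

∈-replicate : ∀ {A : Set} k {x y : A} → y ∈ replicate k x → y ≡ x
∈-replicate (suc k) (here eq)  = eq
∈-replicate (suc k) (there y∈) = ∈-replicate k y∈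

module _ {n : ℕ} where

  ≈ᶜ-refl : {b : Boundary n} → b ≈ᶜ b
  ≈ᶜ-refl {b} = b , [] , sym (++-identityʳ b) , refl

  ≈ᶜ⇒↭ : {b b′ : Boundary n} → b ≈ᶜ b′ → b ↭ b′
  ≈ᶜ⇒↭ (xs , ys , refl , refl) = ++-comm xs ys

  replicate-split : ∀ k {a z t : Fin n} {xs ys} → replicate k a ++ [ z ] ≡ xs ++ t ∷ ys →
                    t ≡ a ⊎ (t ≡ z × xs ≡ replicate k a × ys ≡ [])
  replicate-split zero    {xs = []}         refl = inj₂ (refl , refl , refl)
  replicate-split zero    {xs = _ ∷ []}     ()
  replicate-split zero    {xs = _ ∷ _ ∷ _}  ()
  replicate-split (suc k) {xs = []}         refl = inj₁ refl
  replicate-split (suc k) {xs = x ∷ xs}     eq with ∷-injective eq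
  ... | refl , eq′ = Sum.map₂ (λ (p , q , r) → p , cong (x ∷_) q , r) (replicate-split k eq′)

  -- Two tips other than those of `a` can only be the two ends, met in either order; this also fixes
  -- the two arcs between them.
  cyclic-split : ∀ k {w a z s t : Fin n} {xs ys} →
                 (w ∷ replicate k a ++ [ z ]) ≈ᶜ (s ∷ xs ++ t ∷ ys) →
                 s ≡ a ⊎ t ≡ a ⊎
                 (s ≡ w × t ≡ z × xs ≡ replicate k a × ys ≡ []) ⊎
                 (s ≡ z × t ≡ w × xs ≡ [] × ys ≡ replicate k a)
  cyclic-split k {w} {a} {z} ([] , _ , refl , eq) with ∷-injective (trans eq (++-identityʳ _))
  ... | s≡w , eq′ = inj₂ (Sum.map₂ (λ p → inj₁ (s≡w , p)) (replicate-split k (sym eq′)))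
  -- A cut after the last tip amounts to no cut.
  cyclic-split k {w} {a} {z} (_ ∷ xs₀ , [] , eq₀ , eq)
    with ∷-injective (trans eq (sym (trans eq₀ (++-identityʳ _))))
  ... | s≡w , eq′ = inj₂ (Sum.map₂ (λ p → inj₁ (s≡w , p)) (replicate-split k (sym eq′)))
  -- Here `s` is the first tip after a proper cut. If it is not a tip of `a`, it is the last tip
  -- `z`, and `t` is found in the remaining `w` followed by tips of `a`.
  cyclic-split k {w} {a} {z} {xs = xs} (_ ∷ xs₀ , _ ∷ ys₀ , eq₀ , eq)
    with ∷-injective eq₀ | ∷-injective eq
  ... | refl , eq₁ | refl , eq₂ with replicate-split k {xs = xs₀} eq₁
  ...   | inj₁ s≡a = inj₁ s≡a
  ...   | inj₂ (s≡z , refl , refl) = inj₂ (last s≡z xs eq₂)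
    where
    last : ∀ {s t ys} → s ≡ z → ∀ xs → xs ++ t ∷ ys ≡ w ∷ replicate k a → t ≡ a ⊎
           (s ≡ w × t ≡ z × xs ≡ replicate k a × ys ≡ []) ⊎
           (s ≡ z × t ≡ w × xs ≡ [] × ys ≡ replicate k a)
    last s≡z [] refl = inj₂ (inj₂ (s≡z , refl , refl , refl))
    last _ (_ ∷ xs) eq = inj₁ (∈-replicate k
      (subst (_ ∈_) (∷-injectiveʳ eq) (∈-++⁺ʳ xs (here refl))))

-- Blocked and live regions

-- By `close⇒girth<4` no two tips of the region can be joined, whether or not they share a boundary
-- component.
Blocked : ∀ {n} → Graph n → Region n → Set
Blocked G R = ∀ u v → u ∈ concat R → v ∈ concat R → Close G u v

blocked-shift : ∀ {n s t} {G : Graph n} {R} → Blocked G R → Blocked (addPath s t G) (shiftʳ R)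
blocked-shift {R = R} bl u v u∈ v∈
  with ∈-map⁻ suc (subst (_ ∈_) (concat-map R) u∈) | ∈-map⁻ suc (subst (_ ∈_) (concat-map R) v∈)
... | _ , u∈R , refl | _ , v∈R , refl = close-addPath (bl _ _ u∈R v∈R)

-- A region in which only w and z may be joined.
record Live {n : ℕ} (G : Graph n) : Set where
  constructor live
  field
    w a z  : Fin n
    m      : ℕ
    a-w    : Close G a w
    a-z    : Close G a z

  boundary : Boundary n
  boundary = w ∷ replicate (suc m) a ++ [ z ]

  region : Region n
  region = [ boundary ]

  a-close : ∀ {v} → v ∈ boundary → Close G a v
  a-close (here refl) = a-w
  a-close (there v∈) with ∈-++⁻ (replicate (suc m) a) v∈
  ... | inj₁ v∈ = inj₁ (sym (∈-replicate (suc m) v∈))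
  ... | inj₂ (here refl) = a-z

live-shift : ∀ {n s t} {G : Graph n} → Live G → Live (addPath s t G)
live-shift (live w a z m a-w a-z) =
  live (suc w) (suc a) (suc z) m (close-addPath a-w) (close-addPath a-z)

region-shift : ∀ {n s t} {G : Graph n} (L : Live G) →
               shiftʳ (Live.region L) ≡ Live.region (live-shift {s = s} {t} L)
region-shift (live w a z m _ _) = cong (λ b → [ suc w ∷ suc a ∷ b ])
  (trans (map-++ suc (replicate m a) [ z ]) (cong (_++ [ suc z ]) (map-replicate suc m a)))

-- The first player has joined the end vertices s and t, and the second player
-- the new vertex to one of the outermost tips between them.
afterRound : ∀ {n} {G : Graph n} → Live G → List (Region n) → Fin n → Fin n → Position (2 + n)
afterRound {G = G} L Rs s t = position (addAnswered s t a G)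
  ([ [ zero ] ] ∷ [ zero ∷ shiftᵇ (shiftᵇ (replicate m a)) ] ∷
   map shiftʳ ([ [ zero ] ] ∷ map shiftʳ Rs))
  where open Live L

Ends : ∀ {n} {G : Graph n} → Live G → Fin n → Fin n → Set
Ends L s t = (s ≡ w × t ≡ z) ⊎ (s ≡ z × t ≡ w)
  where open Live L

-- What the second player needs to know about a region before the first player moves there. Both
-- orders of the ends occur, because the new edges are listed in the direction of the curve.
data Answerable {n} (P : Position n) (R : Region n) (Rs : List (Region n)) : Set where
  blocked  : Blocked (graph P) R → Answerable P R Rs
  openEnds : (L : Live (graph P)) → R ≡ Live.region L →
             (∀ {s t} → Ends L s t →
                𝒫₄ (addAnswered s t (Live.a L) (graph P)) × OpponentWins 𝒫₄ (afterRound L Rs s t)) →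
             Answerable P R Rs

Answerable-split : ∀ {n} {P : Position n} {R Rs b bs u v xs ys cs ds} →
  Answerable P R Rs → R ↭ b ∷ bs → b ≈ᶜ (u ∷ xs ++ v ∷ ys) → bs ↭ cs ++ ds →
  let Q = position (addPath u v (graph P))
                   (((zero ∷ shiftᵇ xs) ∷ shiftʳ cs) ∷ ((zero ∷ shiftᵇ ys) ∷ shiftʳ ds) ∷ map shiftʳ Rs)
  in 𝒫₄ (graph Q) → MoverWins 𝒫₄ Q
Answerable-split {R = R} {b = b} {u = u} {v} {xs} (blocked bl) r c d (_ , girth) =
  contradiction girth (close⇒girth<4 (bl _ _ (tip (here refl)) (tip (there (∈-++⁺ʳ xs (here refl))))))
  where
  tip : ∀ {x} → x ∈ _ → x ∈ concat R
  tip x∈ = ∈-concat⁺′ (∈-resp-↭ (↭-sym (≈ᶜ⇒↭ c)) x∈) (∈-resp-↭ (↭-sym r) (here refl))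
-- A live region has a single boundary component, so `cs` and `ds` are empty.
Answerable-split {xs = xs} {ys} {cs} {ds} (openEnds L refl reply) r c d (_ , girth)
  with refl ← ↭-singleton-inv (↭-sym r)
  with cs | ds | ↭-empty-inv (↭-sym d)
... | [] | [] | refl with cyclic-split (suc (Live.m L)) c
... | inj₁ refl = contradiction girth (close⇒girth<4
      (Live.a-close L (∈-resp-↭ (↭-sym (≈ᶜ⇒↭ c)) (there (∈-++⁺ʳ xs (here refl))))))
... | inj₂ (inj₁ refl) = contradiction girth (close⇒girth<4
      (close-sym (Live.a-close L (∈-resp-↭ (↭-sym (≈ᶜ⇒↭ c)) (here refl)))))
-- The tips of `a` all lie in the first new region. Joining the crossbar to the first of them leaves
-- an empty arc on one side and `m` tips on the other.
... | inj₂ (inj₂ (inj₁ (refl , refl , refl , refl))) =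
      let (p , wins) = reply (inj₁ (refl , refl))
      in move _ (split {xs = []} {cs = []} {ds = []} ↭-refl ↭-refl ≈ᶜ-refl ↭-refl , p) wins
... | inj₂ (inj₂ (inj₂ (refl , refl , refl , refl))) =
      let (p , wins) = reply (inj₂ (refl , refl))
      -- Now the tips of `a` lie in the second new region, which is brought to the front.
      in move _ (split {xs = []} {cs = []} {ds = []} (↭-swap _ _ ↭-refl) ↭-refl ≈ᶜ-refl ↭-refl , p) wins

-- Only splits need an answer: a merge is impossible in a blocked region, and a live one has just
-- one boundary component.
round : ∀ {n} {P : Position n} →
        (∀ {R Rs} → regions P ↭ R ∷ Rs → Answerable P R Rs) → OpponentWins 𝒫₄ P
round {P = P} answerable = answer λ
  { _ (split p r c d , valid) → Answerable-split (answerable p) r c d valid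
  ; _ (merge p r c c′ , valid) → merged (answerable p) r c c′ (proj₂ valid) }
  where
  merged : ∀ {A : Set} {R Rs b b′ bs u v xs ys} → Answerable P R Rs → R ↭ b ∷ b′ ∷ bs →
           b ≈ᶜ (u ∷ xs) → b′ ≈ᶜ (v ∷ ys) → GirthAtLeast (addPath u v (graph P)) 4 → A
  merged (blocked bl) r c c′ girth = contradiction girth (close⇒girth<4
    (bl _ _ (∈-concat⁺′ (∈-resp-↭ (↭-sym (≈ᶜ⇒↭ c)) (here refl)) (∈-resp-↭ (↭-sym r) (here refl)))
        (∈-concat⁺′ (∈-resp-↭ (↭-sym (≈ᶜ⇒↭ c′)) (here refl)) (∈-resp-↭ (↭-sym r) (there (here refl))))))
  merged (openEnds L refl _) r _ _ _ with ↭-length r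
  ... | ()

-- Positions with no, one or two live regions

∈-↭-∷ : ∀ {A : Set} {x y : A} {xs ys} → x ∷ xs ↭ y ∷ ys → (y ≡ x × xs ↭ ys) ⊎ y ∈ xs
∈-↭-∷ p with ∈-resp-↭ (↭-sym p) (here refl)
... | here refl = inj₁ (refl , drop-∷ p)
... | there y∈  = inj₂ y∈

↭-pair-inv : ∀ {A : Set} {x y z : A} {zs} → x ∷ y ∷ [] ↭ z ∷ zs →
             (z ≡ x × zs ≡ [ y ]) ⊎ (z ≡ y × zs ≡ [ x ])
↭-pair-inv p with ∈-↭-∷ p
... | inj₁ (refl , q)  = inj₁ (refl , ↭-singleton-inv (↭-sym q))
... | inj₂ (here refl) = inj₂ (refl , ↭-singleton-inv (↭-sym (drop-∷ (↭-trans (↭-swap _ _ ↭-refl) p))))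

allBlocked⇒wins : ∀ {n} {P : Position n} → All (Blocked (graph P)) (regions P) → OpponentWins 𝒫₄ P
allBlocked⇒wins bs = round λ p → blocked (All.lookup bs (∈-resp-↭ (↭-sym p) (here refl)))

singleton-blocked : ∀ {n} {G : Graph n} v → Blocked G [ [ v ] ]
singleton-blocked v _ _ (here refl) (here refl) = inj₁ refl

star-blocked : ∀ {n} {G : Graph n} {x a} k → Close G x a → Blocked G [ x ∷ replicate k a ]
star-blocked {G = G} {x} {a} k close u v u∈ v∈ with tip u∈ | tip v∈
  where
  tip : ∀ {u} → u ∈ (x ∷ replicate k a) ++ [] → u ≡ x ⊎ u ≡ a
  tip (here refl) = inj₁ refl
  tip (there u∈)  = inj₂ (∈-replicate k (subst (_ ∈_) (++-identityʳ _) u∈))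
... | inj₁ refl | inj₁ refl = inj₁ refl
... | inj₁ refl | inj₂ refl = close
... | inj₂ refl | inj₁ refl = close-sym {G = G} close
... | inj₂ refl | inj₂ refl = inj₁ refl

module _ {n : ℕ} {G : Graph n} (L : Live G) {s t : Fin n} where
  open Live L

  newRegions : List (Region (2 + n))
  newRegions = [ [ zero ] ] ∷ [ zero ∷ shiftᵇ (shiftᵇ (replicate m a)) ] ∷ [ [ suc zero ] ] ∷ []

  -- Two of the regions hold a single tip, and in the other one the newest crossbar is adjacent to
  -- `a`.
  newRegions-blocked : All (Blocked (addAnswered s t a G)) newRegions
  newRegions-blocked =
    singleton-blocked zero ∷
    subst (λ b → Blocked (addAnswered s t a G) [ zero ∷ b ])
      (sym (trans (cong shiftᵇ (map-replicate suc m a)) (map-replicate suc m (suc a))))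
      (star-blocked m close-crossbar) ∷
    singleton-blocked (suc zero) ∷ []

  afterRound-blocked : ∀ {Rs} → All (Blocked G) Rs →
    All (Blocked (addAnswered s t a G)) (regions (afterRound L Rs s t))
  afterRound-blocked bs = All.++⁺ newRegions-blocked
    (All.map⁺ (All.map⁺ (All.map (λ {R} b → blocked-shift {R = shiftʳ R} (blocked-shift {R = R} b)) bs)))

-- The round played in the live region leaves only blocked regions, so the first player is then
-- stuck.
oneLive⇒wins : ∀ {n} {P : Position n} (L : Live (graph P)) {Rs} →
               regions P ↭ Live.region L ∷ Rs → All (Blocked (graph P)) Rs →
               (∀ {s t} → Ends L s t → 𝒫₄ (addAnswered s t (Live.a L) (graph P))) → OpponentWins 𝒫₄ P
oneLive⇒wins {P = P} L p bs valid = round λ q → answerable (↭-trans (↭-sym p) q)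
  where
  answerable : ∀ {R Rs} → Live.region L ∷ _ ↭ R ∷ Rs → Answerable P R Rs
  answerable q with ∈-↭-∷ q
  ... | inj₁ (refl , q′) = openEnds L refl λ ends →
        valid ends , allBlocked⇒wins (afterRound-blocked L (All-resp-↭ q′ bs))
  ... | inj₂ R∈ = blocked (All.lookup bs R∈)

twoLive⇒wins : ∀ {n} {P : Position n} (L L′ : Live (graph P)) →
               regions P ≡ Live.region L ∷ Live.region L′ ∷ [] →
               (∀ {s t} → Ends L s t → 𝒫₄ (addAnswered s t (Live.a L) (graph P)) ×
                  OpponentWins 𝒫₄ (afterRound L [ Live.region L′ ] s t)) →
               (∀ {s t} → Ends L′ s t → 𝒫₄ (addAnswered s t (Live.a L′) (graph P)) ×
                  OpponentWins 𝒫₄ (afterRound L′ [ Live.region L ] s t)) →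
               OpponentWins 𝒫₄ P
twoLive⇒wins {P = P} L L′ eq reply reply′ = round λ p → answerable (↭-trans (↭-reflexive (sym eq)) p)
  where
  answerable : ∀ {R Rs} → Live.region L ∷ Live.region L′ ∷ [] ↭ R ∷ Rs → Answerable P R Rs
  answerable p with ↭-pair-inv p
  ... | inj₁ (refl , refl) = openEnds L refl reply
  ... | inj₂ (refl , refl) = openEnds L′ refl reply′

-- After the round in `L`, the only live region is `L′`, its vertices shifted by the two moves.
secondRound⇒wins : ∀ {n} {G : Graph n} (L L′ : Live G) {s t} →
  (∀ {s′ t′} → Ends (live-shift {s = zero} {suc (Live.a L)} (live-shift {s = s} {t} L′)) s′ t′ →
     𝒫₄ (addAnswered s′ t′ (suc (suc (Live.a L′))) (addAnswered s t (Live.a L) G))) →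
  OpponentWins 𝒫₄ (afterRound L [ Live.region L′ ] s t)
secondRound⇒wins L L′ {s} {t} valid = oneLive⇒wins L₂
  (↭-trans (↭-reflexive (cong (λ R → newRegions L {s} {t} ++ [ R ])
     (trans (cong shiftʳ (region-shift {s = s} {t} L′)) (region-shift {s = zero} {suc (Live.a L)} L₁))))
     (++-comm (newRegions L {s} {t}) _))
  (newRegions-blocked L) valid
  where
  L₁ = live-shift {s = s} {t} L′
  L₂ = live-shift {s = zero} {suc (Live.a L)} L₁

-- The opening

spot-adjacent : ∀ i c → (zero , 2 ↑ʳ c) ∈ edges (graph₂ i) × (suc zero , 2 ↑ʳ c) ∈ edges (graph₂ i)
spot-adjacent zero       zero       = here refl , there (there (here refl))
spot-adjacent zero       (suc zero) = there (here refl) , there (there (there (here refl)))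
spot-adjacent (suc zero) zero       = there (here refl) , there (there (there (here refl)))
spot-adjacent (suc zero) (suc zero) = here refl , there (there (here refl))

spotRegion : ∀ i → Fin 2 → ℕ → Live (graph₂ i)
spotRegion i c m = live zero (2 ↑ʳ c) (suc zero) m
  (inj₂ (inj₂ (proj₁ (spot-adjacent i c)))) (inj₂ (inj₂ (proj₂ (spot-adjacent i c))))

-- The ends of both live regions are the same two crossbars, so the two rounds lead to `graph₄` and
-- then `graph₆`; `j` tells at which crossbar the third move starts.
spotRegion-reply : ∀ i c m m′ {s t} (let L = spotRegion i c m ; L′ = spotRegion i (opposite c) m′) →
  Ends L s t → 𝒫₄ (addAnswered s t (2 ↑ʳ c) (graph₂ i)) ×
               OpponentWins 𝒫₄ (afterRound L [ Live.region L′ ] s t)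
spotRegion-reply i c m m′ = λ
  { (inj₁ (refl , refl)) → reply zero ; (inj₂ (refl , refl)) → reply (suc zero) }
  where
  L = spotRegion i c m
  L′ = spotRegion i (opposite c) m′
  reply : ∀ j (let s = j ↑ˡ 2 ; t = opposite j ↑ˡ 2) →
          𝒫₄ (graph₄ i c j) × OpponentWins 𝒫₄ (afterRound L [ Live.region L′ ] s t)
  reply j = graph₄-𝒫₄ i c j , secondRound⇒wins L L′ λ
    { (inj₁ (refl , refl)) → graph₆-𝒫₄ i c j zero ; (inj₂ (refl , refl)) → graph₆-𝒫₄ i c j (suc zero) }

joined : Fin 2 → ℕ → ℕ → Position 3
joined i m m′ = position (addPath i (opposite i) (mkGraph []))
  ([ zero ∷ shiftᵇ (replicate (2 + m) i) ++ zero ∷ shiftᵇ (replicate (2 + m′) (opposite i)) ] ∷ [])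

joined⇒moverWins : ∀ i m m′ → MoverWins 𝒫₄ (joined i m m′)
joined⇒moverWins i m m′ = move _
  -- The curve joins the tips that directly follow the two tips of the first crossbar. Each spot had
  -- at least three tips and has lost two, so each side keeps one at least.
  (split {xs = X ++ [ zero ]} {X′ ++ [ zero ]} {cs = []} {[]} ↭-refl ↭-refl
     ([ zero ] , suc i ∷ X ++ zero ∷ suc (opposite i) ∷ X′ , refl , cong (suc i ∷_)
       (trans (++-assoc X _ _) (sym (++-assoc X _ _))))
     ↭-refl , graph₂-𝒫₄ i)
  (twoLive⇒wins (spotRegion i i m) (spotRegion i (opposite i) m′)
    (cong₂ (λ b b′ → [ zero ∷ b ] ∷ [ zero ∷ b′ ] ∷ []) (shifted i m) (shifted (opposite i) m′))
    (spotRegion-reply i i m m′)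
    -- From the side of `opposite i`, the other side belongs to `opposite (opposite i)`, that is, to
    -- `i`.
    (λ {s} {t} ends → subst
      (λ c → 𝒫₄ (addAnswered s t (2 ↑ʳ opposite i) (graph₂ i)) × OpponentWins 𝒫₄
               (afterRound (spotRegion i (opposite i) m′) [ Live.region (spotRegion i c m) ] s t))
      (opposite-involutive i) (spotRegion-reply i (opposite i) m′ m ends)))
  where
  X = shiftᵇ (replicate (1 + m) i)
  X′ = shiftᵇ (replicate (1 + m′) (opposite i))
  shifted : ∀ (c : Fin 2) k →
            shiftᵇ (shiftᵇ (replicate (suc k) c) ++ [ zero ]) ≡ replicate (suc k) (2 ↑ʳ c) ++ [ suc zero ]
  shifted c k = trans (map-++ suc (shiftᵇ (replicate (suc k) c)) [ zero ])
    (cong (_++ [ suc zero ])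
      (trans (cong shiftᵇ (map-replicate suc (suc k) c)) (map-replicate suc (suc k) (suc c))))

-- Rotating a constant sequence does not change it, so it does not matter which tips of the spots
-- the first move uses.
uncons-replicate : ∀ {n} k {x u : Fin n} {xs} → replicate (suc k) x ≈ᶜ (u ∷ xs) →
                   u ≡ x × xs ≡ replicate k x
uncons-replicate k {x} {xs = xs} c =
  constant (here refl) , trans (all-replicate xs (constant ∘ there)) (cong (λ l → replicate l x) length≡)
  where
  constant : ∀ {y} → y ∈ _ ∷ xs → y ≡ x
  constant y∈ = ∈-replicate (suc k) (∈-resp-↭ (↭-sym (≈ᶜ⇒↭ c)) y∈)
  all-replicate : ∀ ys → (∀ {y} → y ∈ ys → y ≡ x) → ys ≡ replicate (length ys) x
  all-replicate []       eq = refl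
  all-replicate (y ∷ ys) eq = cong₂ _∷_ (eq (here refl)) (all-replicate ys (eq ∘ there))
  length≡ : length xs ≡ k
  length≡ = ℕ.suc-injective (trans (sym (↭-length (≈ᶜ⇒↭ c))) (length-replicate (suc k)))

corollary6p2 : (p q : ℕ) → 3 ≤ p → 3 ≤ q → SecondPlayerWinsBS₂ 𝒫₄ p q
corollary6p2 (suc (suc (suc m))) (suc (suc (suc m′))) (s≤s (s≤s (s≤s z≤n))) (s≤s (s≤s (s≤s z≤n))) =
  answer λ { Q (mv , valid) → reply mv (proj₂ valid) }
  where
  P = BS₂-start (3 + m) (3 + m′)
  sameSpot : ∀ k {x u v : Fin 2} {xs ys} → replicate k x ≈ᶜ (u ∷ xs ++ v ∷ ys) → u ≡ v
  sameSpot k {xs = xs} c = trans (constant (here refl)) (sym (constant (there (∈-++⁺ʳ xs (here refl)))))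
    where
    constant : ∀ {y} → y ∈ _ → y ≡ _
    constant y∈ = ∈-replicate k (∈-resp-↭ (↭-sym (≈ᶜ⇒↭ c)) y∈)
  reply : ∀ {Q} → Move P Q → GirthAtLeast (graph Q) 4 → MoverWins 𝒫₄ Q
  -- Each initial boundary component carries the tips of one spot only, so a split would join a spot
  -- to itself.
  reply (split p r c d) girth with refl ← ↭-singleton-inv (↭-sym p) with ↭-pair-inv r
  ... | inj₁ (refl , _) = contradiction girth (close⇒girth<4 (inj₁ (sameSpot (3 + m) c)))
  ... | inj₂ (refl , _) = contradiction girth (close⇒girth<4 (inj₁ (sameSpot (3 + m′) c)))
  reply (merge p r c c′) girth with refl ← ↭-singleton-inv (↭-sym p) with ↭-pair-inv r
  ... | inj₁ (refl , refl) with refl , refl ← uncons-replicate (2 + m) c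
                              | refl , refl ← uncons-replicate (2 + m′) c′ = joined⇒moverWins zero m m′
  -- The curve starts at the second spot, so the two numbers of tips change places.
  ... | inj₂ (refl , refl) with refl , refl ← uncons-replicate (2 + m′) c
                              | refl , refl ← uncons-replicate (2 + m) c′ = joined⇒moverWins (suc zero) m′ m
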